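{- Let $n$ be a non-negative integer and let $f_n(x):=\mathrm{lcm}(n)\cdot\binom{x}{n}$ for $x\in\mathbb{Z}$. Then $f_n$ preserves all congruences of $(\mathbb{Z},+)$.
   Context: Here $\mathrm{lcm}(0):=1$ and, for $n\geq 1$, $\mathrm{lcm}(n)$ denotes the least common multiple of $1,\dots,n$. For $x\in\mathbb{Z}$, $\binom{x}{n}:=\frac{x(x-1)\cdots(x-n+1)}{n!}$ (equal to $1$ for $n=0$). The congruences of $(\mathbb{Z},+)$ are the relations $\equiv_r$, $r$ a non-negative integer, where $x\equiv_r y$ iff $x-y$ is a multiple of $r$. A map $f:\mathbb{Z}\to\mathbb{Z}$ preserves $\equiv_r$ if $x\equiv_r y$ implies $f(x)\equiv_r f(y)$. -}

module Defs where

open import Data.Nat.Base as ℕ using (ℕ; zero; suc; _!)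
import Data.Nat.Divisibility as ℕ
open import Data.Nat.LCM using (lcm)
open import Data.Nat.Properties using (_!≢0)
open import Data.Integer.Base
  using (ℤ; +_; -[1+_]; 0ℤ; 1ℤ; _+_; _-_; _*_; _/ℕ_; _%ℕ_)
open import Data.Integer.DivMod using (a≡a%ℕn+[a/ℕn]*n; n%ℕd<d)
open import Data.Integer.Divisibility.Signed
open import Data.Integer.Properties
open import Data.Integer.Tactic.RingSolver using (solve-∀)
open import Level using (0ℓ)
open import Relation.Binary.Core using (Rel)
open import Relation.Binary.PropositionalEquality
open import Relation.Nullary.Negation using (contradiction)

lcmUpTo : ℕ → ℕ
lcmUpTo zero    = 1
lcmUpTo (suc n) = lcm (lcmUpTo n) (suc n)

-- x (x - 1) ⋯ (x - n + 1)
falling : ℤ → ℕ → ℤ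
falling x zero    = 1ℤ
falling x (suc n) = falling x n * (x - + n)

-- _/ℕ_ rounds, but here the division is always exact: see binom-exact.
binom : ℤ → ℕ → ℤ
binom x n = (falling x n /ℕ (n !)) {{n !≢0}}

f : ℕ → ℤ → ℤ
f n x = + lcmUpTo n * binom x n

-- For r = 0 this is equality.
Cong : ℕ → Rel ℤ 0ℓ
Cong r x y = + r ∣ x - y

falling-shift : ∀ x n → falling (1ℤ + x) (suc n) ≡ (1ℤ + x) * falling x n
falling-shift x zero    = lem x
  where
  lem : ∀ x → 1ℤ * ((1ℤ + x) - 0ℤ) ≡ (1ℤ + x) * 1ℤ
  lem = solve-∀
falling-shift x (suc n) = begin
  falling (1ℤ + x) (suc n) * ((1ℤ + x) - (1ℤ + + n))
    ≡⟨ cong (_* ((1ℤ + x) - (1ℤ + + n))) (falling-shift x n) ⟩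
  (1ℤ + x) * falling x n * ((1ℤ + x) - (1ℤ + + n))
    ≡⟨ lem x (falling x n) (+ n) ⟩
  (1ℤ + x) * (falling x n * (x - + n)) ∎
  where
  open ≡-Reasoning
  lem : ∀ x y m → (1ℤ + x) * y * ((1ℤ + x) - (1ℤ + m)) ≡ (1ℤ + x) * (y * (x - m))
  lem = solve-∀

falling-pascal : ∀ x n →
  falling (1ℤ + x) (suc n) ≡ falling x (suc n) + + suc n * falling x n
falling-pascal x n = trans (falling-shift x n) (lem x (falling x n) (+ n))
  where
  lem : ∀ x y m → (1ℤ + x) * y ≡ y * (x - m) + (1ℤ + m) * y
  lem = solve-∀

falling-0 : ∀ n → falling 0ℤ (suc n) ≡ 0ℤ
falling-0 zero    = refl
falling-0 (suc n) = cong (_* (0ℤ - + suc n)) (falling-0 n)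

n!∣falling : ∀ n x → + (n !) ∣ falling x n
n!∣falling zero    x = ∣-refl
n!∣falling (suc n) = go
  where
  step : ∀ x → + (suc n !) ∣ + suc n * falling x n
  step x = subst (_∣ + suc n * falling x n) (sym (pos-* (suc n) (n !)))
                 (*-monoʳ-∣ (+ suc n) (n!∣falling n x))

  up : ∀ x → + (suc n !) ∣ falling x (suc n) → + (suc n !) ∣ falling (1ℤ + x) (suc n)
  up x d = subst (+ (suc n !) ∣_) (sym (falling-pascal x n)) (∣m∣n⇒∣m+n d (step x))

  down : ∀ x → + (suc n !) ∣ falling (1ℤ + x) (suc n) → + (suc n !) ∣ falling x (suc n)
  down x d = ∣m+n∣n⇒∣m {m = falling x (suc n)}
               (subst (+ (suc n !) ∣_) (falling-pascal x n) d) (step x)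

  go : ∀ x → + (suc n !) ∣ falling x (suc n)
  go (+ zero)      = subst (+ (suc n !) ∣_) (sym (falling-0 n)) (divides 0ℤ refl)
  go (+ suc m)     = up (+ m) (go (+ m))
  go -[1+ zero ]   = down -[1+ zero ] (go (+ zero))
  go -[1+ suc m ]  = down -[1+ suc m ] (go -[1+ m ])

binom-exact : ∀ x n → binom x n * + (n !) ≡ falling x n
binom-exact x n = exact (falling x n) (n !) {{n !≢0}} (n!∣falling n x)
  where
  small : ∀ r d → r ℕ.< d → d ℕ.∣ r → r ≡ 0
  small zero    d _   _   = refl
  small (suc r) d r<d d∣r = contradiction d∣r (ℕ.>⇒∤ r<d)

  exact : ∀ a d .{{_ : ℕ.NonZero d}} → + d ∣ a → (a /ℕ d) * + d ≡ a
  exact a d d∣a = sym (trans a≡ (trans (cong (λ r → + r + q * + d) r≡0) (+-identityˡ (q * + d))))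
    where
    q = a /ℕ d
    a≡ : a ≡ + (a %ℕ d) + q * + d
    a≡ = a≡a%ℕn+[a/ℕn]*n a d
    r≡0 : a %ℕ d ≡ 0
    r≡0 = small (a %ℕ d) d (n%ℕd<d a d)
            (∣⇒∣ᵤ (∣m+n∣n⇒∣m {m = + (a %ℕ d)} (subst (+ d ∣_) a≡ d∣a) (divides q refl)))

{-# OPTIONS --safe #-}
-- Put D n x = binom (a + x) n - binom x n. By Pascal's rule
-- D (n + 1) (x + 1) = D (n + 1) x + D n x, so by induction on n and then on x
-- (in both directions), a ∣ lcm(n) D n x reduces to x = 0. There the absorption
-- identity n binom a n = a binom (a - 1) (n - 1) and n ∣ lcm(n) give the claim.
module Submission where

open import Defs
open import Data.Nat.Base using (ℕ; zero; suc; _!)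
open import Data.Nat.LCM using (m∣lcm[m,n]; n∣lcm[m,n])
open import Data.Nat.Properties using (_!≢0)
open import Data.Integer.Base using (ℤ; +_; -[1+_]; 0ℤ; 1ℤ; _+_; _-_; _*_)
open import Data.Integer.Divisibility.Signed
open import Data.Integer.Properties
open import Data.Integer.Tactic.RingSolver using (solve-∀)
open import Function.Bundles using (_⇔_; mk⇔; Equivalence)
open import Relation.Binary.Core using (_Preserves_⟶_)
open import Relation.Binary.PropositionalEquality

-- The step is an equivalence because its forward half climbs from `0ℤ` to the positive integers and
-- its backward half descends to the negative ones.
ℤ-induction : ∀ {p} (P : ℤ → Set p) → P 0ℤ → (∀ x → P x ⇔ P (1ℤ + x)) → ∀ x → P x
ℤ-induction P p₀ step (+ zero)     = p₀
ℤ-induction P p₀ step (+ suc m)    =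
  Equivalence.to (step (+ m)) (ℤ-induction P p₀ step (+ m))
ℤ-induction P p₀ step -[1+ zero ]  = Equivalence.from (step -[1+ zero ]) p₀
ℤ-induction P p₀ step -[1+ suc m ] =
  Equivalence.from (step -[1+ suc m ]) (ℤ-induction P p₀ step -[1+ m ])

-- Lets identities between values of `binom` be checked after multiplication by a factorial, where
-- `binom-exact` turns them into identities of falling factorials.
*-!-cancelʳ : ∀ n x y → x * + (n !) ≡ y * + (n !) → x ≡ y
*-!-cancelʳ n x y = *-cancelʳ-≡ x y (+ (n !)) {{n !≢0}}

binom-0 : ∀ n → binom 0ℤ (suc n) ≡ 0ℤ
binom-0 n = *-!-cancelʳ (suc n) (binom 0ℤ (suc n)) 0ℤ
  (trans (binom-exact 0ℤ (suc n)) (falling-0 n))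

binom-pascal : ∀ x n → binom (1ℤ + x) (suc n) ≡ binom x (suc n) + binom x n
binom-pascal x n = *-!-cancelʳ (suc n) (binom (1ℤ + x) (suc n)) (b′ + b) (begin
  binom (1ℤ + x) (suc n) * + (suc n !)           ≡⟨ binom-exact (1ℤ + x) (suc n) ⟩
  falling (1ℤ + x) (suc n)                       ≡⟨ falling-pascal x n ⟩
  falling x (suc n) + + suc n * falling x n      ≡⟨ cong₂ (λ u v → u + + suc n * v)
                                                      (binom-exact x (suc n)) (binom-exact x n) ⟨
  b′ * + (suc n !) + + suc n * (b * + (n !))     ≡⟨ cong (λ u → b′ * u + + suc n * (b * + (n !)))
                                                      (pos-* (suc n) (n !)) ⟩
  b′ * (+ suc n * + (n !)) + + suc n * (b * + (n !))
                                                 ≡⟨ lem b′ b (+ suc n) (+ (n !)) ⟩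
  (b′ + b) * (+ suc n * + (n !))                 ≡⟨ cong ((b′ + b) *_) (pos-* (suc n) (n !)) ⟨
  (b′ + b) * + (suc n !)                         ∎)
  where
  open ≡-Reasoning
  b′ = binom x (suc n)
  b  = binom x n
  lem : ∀ u v s t → u * (s * t) + s * (v * t) ≡ (u + v) * (s * t)
  lem = solve-∀

-- Only `n !` is cancelled: on the left the factor `suc n` completes it to `suc n !`, giving
-- `falling (1ℤ + x) (suc n)`, from which `falling-shift` splits off `1ℤ + x`.
binom-absorption : ∀ x n → + suc n * binom (1ℤ + x) (suc n) ≡ (1ℤ + x) * binom x n
binom-absorption x n = *-!-cancelʳ n (+ suc n * b′) ((1ℤ + x) * binom x n) (begin
  + suc n * b′ * + (n !)              ≡⟨ lem (+ suc n) b′ (+ (n !)) ⟩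
  b′ * (+ suc n * + (n !))            ≡⟨ cong (b′ *_) (pos-* (suc n) (n !)) ⟨
  b′ * + (suc n !)                    ≡⟨ binom-exact (1ℤ + x) (suc n) ⟩
  falling (1ℤ + x) (suc n)            ≡⟨ falling-shift x n ⟩
  (1ℤ + x) * falling x n              ≡⟨ cong ((1ℤ + x) *_) (binom-exact x n) ⟨
  (1ℤ + x) * (binom x n * + (n !))    ≡⟨ *-assoc (1ℤ + x) (binom x n) (+ (n !)) ⟨
  (1ℤ + x) * binom x n * + (n !)      ∎)
  where
  open ≡-Reasoning
  b′ = binom (1ℤ + x) (suc n)
  lem : ∀ s u t → s * u * t ≡ u * (s * t)
  lem = solve-∀

a∣suc[n]*binom : ∀ a n → a ∣ + suc n * binom a (suc n)
-- Absorption at `a - 1ℤ`, transported along `1ℤ + (a - 1ℤ) ≡ a`.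
a∣suc[n]*binom a n = subst (λ c → c ∣ + suc n * binom c (suc n)) (lem a)
  (subst (1ℤ + (a - 1ℤ) ∣_) (sym (binom-absorption (a - 1ℤ) n))
    (∣m⇒∣m*n (binom (a - 1ℤ) n) ∣-refl))
  where
  lem : ∀ a → 1ℤ + (a - 1ℤ) ≡ a
  lem = solve-∀

a∣lcm*binom : ∀ a n → a ∣ + lcmUpTo (suc n) * binom a (suc n)
a∣lcm*binom a n = ∣-trans (a∣suc[n]*binom a n)
  (*-monoˡ-∣ (binom a (suc n)) {+ suc n} {+ lcmUpTo (suc n)}
    (∣ᵤ⇒∣ (n∣lcm[m,n] (lcmUpTo n) (suc n))))

a∣lcm*Δbinom : ∀ a n x → a ∣ + lcmUpTo n * (binom (a + x) n - binom x n)
-- `binom` is constantly 1 here, so the difference vanishes.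
a∣lcm*Δbinom a zero    x = divides 0ℤ refl
a∣lcm*Δbinom a (suc n) = ℤ-induction (λ x → a ∣ L * D (suc n) x) base
  (λ x → mk⇔ (λ d → subst (a ∣_) (sym (recurrence x)) (∣m∣n⇒∣m+n d (previous x)))
             (λ d → ∣m+n∣n⇒∣m {m = L * D (suc n) x} (subst (a ∣_) (recurrence x) d) (previous x)))
  where
  open ≡-Reasoning
  L = + lcmUpTo (suc n)

  D : ℕ → ℤ → ℤ
  D k x = binom (a + x) k - binom x k

  previous : ∀ x → a ∣ L * D n x
  -- `lcmUpTo n` divides `L`, so the induction hypothesis for `n` survives the passage to the larger
  -- factor.
  previous x = ∣-trans (a∣lcm*Δbinom a n x)
    (*-monoˡ-∣ (D n x) {+ lcmUpTo n} {L} (∣ᵤ⇒∣ (m∣lcm[m,n] (lcmUpTo n) (suc n))))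

  base : a ∣ L * D (suc n) 0ℤ
  -- Since `binom 0ℤ (suc n)` vanishes, the difference at 0 is `binom a (suc n)` itself.
  base = subst (λ b → a ∣ L * b) (sym (begin
    binom (a + 0ℤ) (suc n) - binom 0ℤ (suc n)  ≡⟨ cong₂ (λ c b → binom c (suc n) - b)
                                                    (+-identityʳ a) (binom-0 n) ⟩
    binom a (suc n) - 0ℤ                       ≡⟨ +-identityʳ (binom a (suc n)) ⟩
    binom a (suc n)                            ∎)) (a∣lcm*binom a n)

  shift : ∀ a x → a + (1ℤ + x) ≡ 1ℤ + (a + x)
  shift = solve-∀

  regroup : ∀ l u v s t → l * ((u + v) - (s + t)) ≡ l * (u - s) + l * (v - t)
  regroup = solve-∀

  recurrence : ∀ x → L * D (suc n) (1ℤ + x) ≡ L * D (suc n) x + L * D n x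
  recurrence x = begin
    L * (binom (a + (1ℤ + x)) (suc n) - binom (1ℤ + x) (suc n))
      ≡⟨ cong (λ c → L * (binom c (suc n) - binom (1ℤ + x) (suc n))) (shift a x) ⟩
    L * (binom (1ℤ + (a + x)) (suc n) - binom (1ℤ + x) (suc n))
      ≡⟨ cong₂ (λ u v → L * (u - v)) (binom-pascal (a + x) n) (binom-pascal x n) ⟩
    L * ((binom (a + x) (suc n) + binom (a + x) n) - (binom x (suc n) + binom x n))
      ≡⟨ regroup L (binom (a + x) (suc n)) (binom (a + x) n) (binom x (suc n)) (binom x n) ⟩
    L * D (suc n) x + L * D n x ∎

-- This is `a∣lcm*Δbinom` with increment `x - y` at the point `y`. No modulus occurs, so it serves
-- all congruences at once.
x-y∣f[x]-f[y] : ∀ n x y → x - y ∣ f n x - f n y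
x-y∣f[x]-f[y] n x y = subst (x - y ∣_) (begin
  L * (binom (x - y + y) n - binom y n)  ≡⟨ cong (λ z → L * (binom z n - binom y n)) (cancel x y) ⟩
  L * (binom x n - binom y n)            ≡⟨ distrib L (binom x n) (binom y n) ⟩
  f n x - f n y                          ∎) (a∣lcm*Δbinom (x - y) n y)
  where
  open ≡-Reasoning
  L = + lcmUpTo n
  cancel : ∀ x y → x - y + y ≡ x
  cancel = solve-∀
  distrib : ∀ l u v → l * (u - v) ≡ l * u - l * v
  distrib = solve-∀

lemma7p7 : (n : ℕ) → (r : ℕ) → f n Preserves Cong r ⟶ Cong r
-- The modulus divides `x - y`, which in turn divides `f n x - f n y`.
lemma7p7 n r {x} {y} r∣x-y = ∣-trans r∣x-y (x-y∣f[x]-f[y] n x y)
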